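{- Let $R$ be a commutative ring with unity, let $\mathcal{A}$ be a commutative unital $R$-algebra, and let $\sigma,\tau$ be two different non-zero unital $R$-algebra endomorphisms of $\mathcal{A}$. Suppose that $\mathcal{A}$ is of finite rank $n$ as an $R$-module, with $R$-basis $\{\alpha_{1},\alpha_{2},\dots,\alpha_{n}\}$. Then a $(\sigma,\tau)$-derivation $D:\mathcal{A}\to\mathcal{A}$ is inner if and only if there exists some $\beta\in\mathcal{A}$ such that $D(\alpha_{i})=\beta(\tau-\sigma)(\alpha_{i})$ for all $i\in\{1,2,\dots,n\}$.
   Context: A $(\sigma,\tau)$-derivation of $\mathcal{A}$ is an $R$-linear map $D:\mathcal{A}\to\mathcal{A}$ with $D(xy)=D(x)\tau(y)+\sigma(x)D(y)$ for all $x,y\in\mathcal{A}$. It is called inner if there exists $\beta\in\mathcal{A}$ with $D(x)=\beta\tau(x)-\sigma(x)\beta$ for all $x\in\mathcal{A}$. Here $(\tau-\sigma)(x)=\tau(x)-\sigma(x)$. -}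

module Defs where

open import Algebra.Bundles using (CommutativeRing; Ring)
open import Algebra.Module.Bundles using (LeftModule)
open import Algebra.Module.Core using (Opₗ)
open import Algebra.Module.Structures using (IsLeftModule)
open import Algebra.Module.Morphism.Structures using (module LeftModuleMorphisms)
open import Algebra.Morphism.Structures using (module RingMorphisms)
import Algebra.Properties.Monoid.Sum as MonoidSum
open import Data.Nat.Base using (ℕ)
open import Data.Product.Base using (∃-syntax)
open import Data.Vec.Functional using (Vector)
open import Level using (Level; _⊔_; suc)
open import Relation.Nullary.Negation.Core using (¬_)

-- Bilinearity of the product is one scalar law: additivity is distributivity
-- of the ring, and the scalar law in the second argument follows by
-- commutativity.
record CommutativeAlgebra {r ℓr : Level} (R : CommutativeRing r ℓr) (a ℓa : Level)
                          : Set (r ⊔ ℓr ⊔ suc (a ⊔ ℓa)) where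
  infixr 7 _*ₗ_
  field
    commutativeRing : CommutativeRing a ℓa
  open CommutativeRing commutativeRing public
  field
    _*ₗ_         : Opₗ (CommutativeRing.Carrier R) Carrier
    isLeftModule : IsLeftModule (CommutativeRing.ring R) _≈_ _+_ 0# -_ _*ₗ_
    *ₗ-*-assoc   : ∀ k x y → (k *ₗ x) * y ≈ k *ₗ (x * y)

  leftModule : LeftModule (CommutativeRing.ring R) a ℓa
  leftModule = record { isLeftModule = isLeftModule }

module _ {r ℓr m ℓm : Level} {R : Ring r ℓr} (M : LeftModule R m ℓm) where
  open Ring R using (Carrier; _≈_; 0#)
  open LeftModule M using (Carrierᴹ; _≈ᴹ_; 0ᴹ; _*ₗ_; +ᴹ-monoid)
  open MonoidSum +ᴹ-monoid using (sum)

  linearCombination : ∀ {n} → Vector Carrier n → Vector Carrierᴹ n → Carrierᴹ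
  linearCombination c v = sum (λ i → c i *ₗ v i)

  record IsBasis {n : ℕ} (v : Vector Carrierᴹ n) : Set (r ⊔ ℓr ⊔ m ⊔ ℓm) where
    field
      spanning    : ∀ x → ∃[ c ] x ≈ᴹ linearCombination c v
      independent : ∀ c → linearCombination c v ≈ᴹ 0ᴹ → ∀ i → c i ≈ 0#

module _ {r ℓr a ℓa : Level} {R : CommutativeRing r ℓr} (A : CommutativeAlgebra R a ℓa) where
  open CommutativeAlgebra A
  open RingMorphisms rawRing rawRing using (IsRingHomomorphism)
  open LeftModuleMorphisms (LeftModule.rawLeftModule leftModule) (LeftModule.rawLeftModule leftModule) using (IsLeftModuleHomomorphism)

  -- The library's module homomorphisms include congruence for _≈_.
  IsLinear : (Carrier → Carrier) → Set (r ⊔ a ⊔ ℓa)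
  IsLinear = IsLeftModuleHomomorphism

  record IsUnitalAlgebraEndomorphism (f : Carrier → Carrier) : Set (r ⊔ a ⊔ ℓa) where
    field
      isRingHomomorphism : IsRingHomomorphism f
      isLinear           : IsLinear f

  NonZeroMap : (Carrier → Carrier) → Set (a ⊔ ℓa)
  NonZeroMap f = ¬ (∀ x → f x ≈ 0#)

  DifferentMaps : (Carrier → Carrier) → (Carrier → Carrier) → Set (a ⊔ ℓa)
  DifferentMaps f g = ¬ (∀ x → f x ≈ g x)

  difference : (Carrier → Carrier) → (Carrier → Carrier) → Carrier → Carrier
  difference f g x = f x - g x

  record IsDerivation (σ τ D : Carrier → Carrier) : Set (r ⊔ a ⊔ ℓa) where
    field
      isLinear : IsLinear D
      leibniz  : ∀ x y → D (x * y) ≈ D x * τ y + σ x * D y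

  IsInner : (σ τ D : Carrier → Carrier) → Set (a ⊔ ℓa)
  IsInner σ τ D = ∃[ β ] ∀ x → D x ≈ β * τ x - σ x * β

{-# OPTIONS --safe #-}

-- Commutativity of 𝒜 rewrites β τ(x) − σ(x) β as β (τ − σ)(x), which is linear
-- in x.  D is inner by β exactly when it equals this linear map, and two linear
-- maps are equal as soon as they agree on a basis.
module Submission where

open import Defs
open import Algebra.Bundles using (CommutativeRing; Ring)
open import Algebra.Module.Bundles using (LeftModule)
open import Algebra.Module.Morphism.Structures using (module LeftModuleMorphisms)
import Algebra.Properties.CommutativeSemigroup as CommutativeSemigroupProperties
import Algebra.Properties.Monoid.Sum as MonoidSum
import Algebra.Properties.Ring as RingProperties
open import Data.Fin.Base using (Fin; zero; suc)
open import Data.Nat.Base using (ℕ)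
open import Data.Product.Base using (∃-syntax; _,_)
open import Data.Vec.Functional using (Vector)
open import Function.Base using (_∘_)
open import Function.Bundles using (_⇔_; mk⇔)
open import Level using (Level)
import Relation.Binary.Reasoning.Setoid as SetoidReasoning

module _ {r ℓr m ℓm m′ ℓm′ : Level} {R : Ring r ℓr}
         (M : LeftModule R m ℓm) (N : LeftModule R m′ ℓm′) where
  private
    module M = LeftModule M
    module N = LeftModule N
  open Ring R using (Carrier)
  open LeftModuleMorphisms M.rawLeftModule N.rawLeftModule using (IsLeftModuleHomomorphism)
  open SetoidReasoning N.≈ᴹ-setoid

  -- Induction on the length. The empty sum is zero, which `f` preserves; a nonempty sum unfolds
  -- definitionally into head plus tail, so additivity and the scalar law handle the head and
  -- induction the tail.
  linearCombination-homo : ∀ {f} → IsLeftModuleHomomorphism f →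
    ∀ {n} (c : Vector Carrier n) (v : Vector M.Carrierᴹ n) →
    f (linearCombination M c v) N.≈ᴹ linearCombination N c (f ∘ v)
  linearCombination-homo f-hom {ℕ.zero} c v = 0ᴹ-homo
    where open IsLeftModuleHomomorphism f-hom
  linearCombination-homo {f} f-hom {ℕ.suc n} c v = begin
    f (c zero M.*ₗ v zero M.+ᴹ linearCombination M (c ∘ suc) (v ∘ suc))
      ≈⟨ +ᴹ-homo _ _ ⟩
    f (c zero M.*ₗ v zero) N.+ᴹ f (linearCombination M (c ∘ suc) (v ∘ suc))
      ≈⟨ N.+ᴹ-cong (*ₗ-homo _ _) (linearCombination-homo f-hom (c ∘ suc) (v ∘ suc)) ⟩
    linearCombination N c (f ∘ v) ∎
    where open IsLeftModuleHomomorphism f-hom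

  -- Spanning writes `x` as a combination of the `v i`. Both maps pass through it with the same
  -- coefficients, so only their values on the `v i` matter.
  homomorphism-ext : ∀ {f g} → IsLeftModuleHomomorphism f → IsLeftModuleHomomorphism g →
    ∀ {n} {v : Vector M.Carrierᴹ n} → IsBasis M v →
    (∀ i → f (v i) N.≈ᴹ g (v i)) → ∀ x → f x N.≈ᴹ g x
  homomorphism-ext {f} {g} f-hom g-hom {v = v} basis f≈g x =
    let c , x≈cv = IsBasis.spanning basis x in begin
    f x                            ≈⟨ F.⟦⟧-cong x≈cv ⟩
    f (linearCombination M c v)    ≈⟨ linearCombination-homo f-hom c v ⟩
    linearCombination N c (f ∘ v)  ≈⟨ sum-cong-≋ (λ i → N.*ₗ-congˡ (f≈g i)) ⟩
    linearCombination N c (g ∘ v)  ≈⟨ linearCombination-homo g-hom c v ⟨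
    g (linearCombination M c v)    ≈⟨ G.⟦⟧-cong x≈cv ⟨
    g x                            ∎
    where
    module F = IsLeftModuleHomomorphism f-hom
    module G = IsLeftModuleHomomorphism g-hom
    open MonoidSum N.+ᴹ-monoid using (sum-cong-≋)

module _ {r ℓr a ℓa : Level} {R : CommutativeRing r ℓr} (A : CommutativeAlgebra R a ℓa) where
  open CommutativeAlgebra A
  open LeftModule leftModule using (*ₗ-congˡ)
  open RingProperties ring
    using (x+x≈x⇒x≈0; x[y-z]≈xy-xz; -‿+-comm; +-inverseˡ-unique)
  open CommutativeSemigroupProperties *-commutativeSemigroup using (x∙yz≈y∙xz)
  open CommutativeSemigroupProperties +-commutativeSemigroup using (interchange)
  open SetoidReasoning setoid
  private
    module Lin {f} (f-lin : IsLinear A f) =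
      LeftModuleMorphisms.IsLeftModuleHomomorphism f-lin

  -- Turns scalar laws into ring laws: once `k` acts as the ring element `k *ₗ 1#`, distributivity
  -- and commutativity in the algebra apply to it.
  *ₗ-as-* : ∀ k x → k *ₗ x ≈ (k *ₗ 1#) * x
  *ₗ-as-* k x = begin
    k *ₗ x         ≈⟨ *ₗ-congˡ (*-identityˡ x) ⟨
    k *ₗ (1# * x)  ≈⟨ *ₗ-*-assoc k 1# x ⟨
    (k *ₗ 1#) * x  ∎

  -- The homomorphism record also asks for preservation of zero and negation. Both follow from
  -- additivity and congruence.
  mkIsLinear : ∀ {f} → (∀ {x y} → x ≈ y → f x ≈ f y) →
    (∀ x y → f (x + y) ≈ f x + f y) → (∀ k x → f (k *ₗ x) ≈ k *ₗ f x) → IsLinear A f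
  mkIsLinear {f} f-cong +-homo *ₗ-homo = record
    { +ᴹ-isGroupHomomorphism = record
      { isMonoidHomomorphism = record
        { isMagmaHomomorphism = record
          { isRelHomomorphism = record { cong = f-cong }
          ; homo              = +-homo
          }
        ; ε-homo = 0-homo
        }
      -- `f (- x)` is a left additive inverse of `f x`, and such inverses are unique.
      ; ⁻¹-homo = λ x → +-inverseˡ-unique (f (- x)) (f x) (begin
          f (- x) + f x  ≈⟨ +-homo (- x) x ⟨
          f (- x + x)    ≈⟨ f-cong (-‿inverseˡ x) ⟩
          f 0#           ≈⟨ 0-homo ⟩
          0#             ∎)
      }
    ; *ₗ-homo = *ₗ-homo
    }
    where
    0-homo : f 0# ≈ 0#
    0-homo = x+x≈x⇒x≈0 (f 0#) (begin
      f 0# + f 0#  ≈⟨ +-homo 0# 0# ⟨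
      f (0# + 0#)  ≈⟨ f-cong (+-identityˡ 0#) ⟩
      f 0#         ∎)

  difference-isLinear : ∀ {f g} → IsLinear A f → IsLinear A g → IsLinear A (difference A f g)
  difference-isLinear {f} {g} f-lin g-lin = mkIsLinear
    (λ x≈y → +-cong (F.⟦⟧-cong x≈y) (-‿cong (G.⟦⟧-cong x≈y)))
    (λ x y → begin
      f (x + y) - g (x + y)          ≈⟨ +-cong (F.+ᴹ-homo x y) (-‿cong (G.+ᴹ-homo x y)) ⟩
      (f x + f y) - (g x + g y)      ≈⟨ +-congˡ (-‿+-comm (g x) (g y)) ⟨
      (f x + f y) + (- g x + - g y)  ≈⟨ interchange (f x) (f y) (- g x) (- g y) ⟩
      (f x - g x) + (f y - g y)      ∎)
    (λ k x → begin
      f (k *ₗ x) - g (k *ₗ x)                ≈⟨ +-cong (F.*ₗ-homo k x) (-‿cong (G.*ₗ-homo k x)) ⟩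
      -- Passing to multiplication by `k *ₗ 1#` lets ring distributivity over subtraction factor out
      -- the scalar.
      k *ₗ f x - k *ₗ g x                    ≈⟨ +-cong (*ₗ-as-* k (f x)) (-‿cong (*ₗ-as-* k (g x))) ⟩
      (k *ₗ 1#) * f x - (k *ₗ 1#) * g x      ≈⟨ x[y-z]≈xy-xz (k *ₗ 1#) (f x) (g x) ⟨
      (k *ₗ 1#) * (f x - g x)                ≈⟨ *ₗ-as-* k (f x - g x) ⟨
      k *ₗ (f x - g x)                       ∎)
    where
    module F = Lin f-lin
    module G = Lin g-lin

  -- Additivity is distributivity. For scalars, `k *ₗ 1#` is an element of a commutative ring and so
  -- moves past `β`.
  *-isLinear : ∀ β {f} → IsLinear A f → IsLinear A (λ x → β * f x)
  *-isLinear β {f} f-lin = mkIsLinear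
    (λ x≈y → *-congˡ (F.⟦⟧-cong x≈y))
    (λ x y → trans (*-congˡ (F.+ᴹ-homo x y)) (distribˡ β (f x) (f y)))
    (λ k x → begin
      β * f (k *ₗ x)         ≈⟨ *-congˡ (F.*ₗ-homo k x) ⟩
      β * (k *ₗ f x)         ≈⟨ *-congˡ (*ₗ-as-* k (f x)) ⟩
      β * ((k *ₗ 1#) * f x)  ≈⟨ x∙yz≈y∙xz β (k *ₗ 1#) (f x) ⟩
      (k *ₗ 1#) * (β * f x)  ≈⟨ *ₗ-as-* k (β * f x) ⟨
      k *ₗ (β * f x)         ∎)
    where module F = Lin f-lin

  -- Commutativity brings `β` to the left of `σ x`, where it factors out. This is the bridge between
  -- the two sides of the equivalence.
  inner-as-difference : ∀ (σ τ : Carrier → Carrier) β x →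
    β * τ x - σ x * β ≈ β * difference A τ σ x
  inner-as-difference σ τ β x = begin
    β * τ x - σ x * β  ≈⟨ +-congˡ (-‿cong (*-comm (σ x) β)) ⟩
    β * τ x - β * σ x  ≈⟨ x[y-z]≈xy-xz β (τ x) (σ x) ⟨
    β * (τ x - σ x)    ∎

theorem2p26 : ∀ {r ℓr a ℓa : Level}
    (R : CommutativeRing r ℓr) (A : CommutativeAlgebra R a ℓa) →
    let open CommutativeAlgebra A in
    (σ τ : Carrier → Carrier) →
    IsUnitalAlgebraEndomorphism A σ → IsUnitalAlgebraEndomorphism A τ →
    NonZeroMap A σ → NonZeroMap A τ → DifferentMaps A σ τ →
    (n : ℕ) (α : Vector Carrier n) → IsBasis leftModule α →
    (D : Carrier → Carrier) → IsDerivation A σ τ D →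
    IsInner A σ τ D ⇔ (∃[ β ] ∀ (i : Fin n) → D (α i) ≈ β * difference A τ σ (α i))
theorem2p26 R A σ τ σ-endo τ-endo _ _ _ n α basis D D-der = mk⇔
  -- The same `β` is the witness in both directions; here the identity is just evaluated at the
  -- basis elements.
  (λ (β , D≈inner) → β , λ i → trans (D≈inner (α i)) (inner-as-difference A σ τ β (α i)))
  (λ (β , D≈diff) → β , λ x → trans
    -- `D` and `β` times the difference of `τ` and `σ` are both linear, so their agreement on `α`
    -- extends to every `x`.
    (homomorphism-ext leftModule leftModule (IsDerivation.isLinear D-der)
      (*-isLinear A β (difference-isLinear A (isLinear τ-endo) (isLinear σ-endo)))
      basis D≈diff x)
    (sym (inner-as-difference A σ τ β x)))
  where
  open CommutativeAlgebra A
  open IsUnitalAlgebraEndomorphism using (isLinear)
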